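{- Let $\mathcal{K}\subseteq\mathcal{L}$ be a fuzzy language over $E$. Let $\mathscr{CO}(\mathcal{K})$ be the set of all fuzzy languages $\mathcal{M}$ over $E$ such that $\mathcal{K}\subseteq\mathcal{M}\subseteq\mathcal{L}$ and $\mathcal{M}$ is controllable and observable, and let $\mathcal{K}^{\downarrow(CO)}=\bigcap_{\mathcal{M}\in\mathscr{CO}(\mathcal{K})}\mathcal{M}$. Then $\mathcal{K}^{\downarrow(CO)}$ is the least controllable and observable fuzzy superlanguage of $\mathcal{K}$; that is, $\mathcal{K}^{\downarrow(CO)}\in\mathscr{CO}(\mathcal{K})$ and $\mathcal{K}^{\downarrow(CO)}\subseteq\mathcal{M}$ for every $\mathcal{M}\in\mathscr{CO}(\mathcal{K})$.
   Context: $E$ is a finite set of events and $E^*$ is the set of all finite strings over $E$, including the empty string $\epsilon$. On $[0,1]$, $\wedge$ denotes infimum. A fuzzy subset of a set $X$ is a function $X\to[0,1]$; $\mathcal{A}\subseteq\mathcal{B}$ means $\mathcal{A}(x)\le\mathcal{B}(x)$ for all $x$; $\mathrm{supp}(\mathcal{A})=\{x:\mathcal{A}(x)>0\}$; intersections are pointwise infima, $(\cap_{i}\mathcal{A}_i)(x)=\wedge_i\mathcal{A}_i(x)$. A fuzzy language over $E$ is a fuzzy subset $\mathcal{A}$ of $E^*$ which is either the empty fuzzy language $\mathcal{O}$ (identically $0$), or satisfies $\mathcal{A}(\epsilon)=1$ and $\mathcal{A}(\mu)\ge\mathcal{A}(\mu\nu)$ for all $\mu,\nu\in E^*$. $\mathcal{L}$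 is a fixed fuzzy language over $E$ (the behavior of the uncontrolled system); $\mathcal{L}\in\mathscr{CO}(\mathcal{K})$, so this class is nonempty. The event set is partitioned as $E=E_c\,\dot\cup\,E_{uc}$ (controllable, uncontrollable) and, independently, as $E=E_o\,\dot\cup\,E_{uo}$ (observable, unobservable). The natural projection $P:E^*\to E_o^*$ erases unobservable events: $P(\epsilon)=\epsilon$, $P(sa)=P(s)P(a)$, where $P(a)=a$ if $a\in E_o$ and $P(a)=\epsilon$ if $a\in E_{uo}$. A fuzzy language $\mathcal{M}\subseteq\mathcal{L}$ is controllable (with respect to $\mathcal{L}$ and $E_{uc}$) if $\mathcal{M}(sa)=\mathcal{M}(s)\wedge\mathcal{L}(sa)$ for all $s\in E^*$ and $a\in E_{uc}$. It is observable (with respect to $\mathcal{L}$, $P$, and $E_c$) if for all $s,s'\in\mathrm{supp}(\mathcal{M})$ with $P(s)=P(s')$ and all $a\in E_c$ with $sa\in\mathrm{supp}(\mathcal{M})$, there is some $x\in[0,1]$ with $\mathcal{M}(sa)=\mathcal{M}(s)\wedge\mathcal{L}(sa)\wedge x$ such that $\mathcal{M}(s'a)=\mathcal{M}(s')\wedge\mathcal{L}(s'a)\wedge x$. -}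

module Defs where

open import Axiom.ExcludedMiddle using (ExcludedMiddle)
import Data.Bool as Bool
open import Data.Bool using (Bool; T)
open import Data.Bool.Properties using (T-∧)
open import Data.List using (List; []; _++_; _∷ʳ_; filter)
open import Data.Product using (Σ-syntax; ∃-syntax; _×_; _,_; proj₁; proj₂)
open import Data.Rational using (ℚ; 0ℚ; 1ℚ; -_; _+_) renaming (_<_ to _<ℚ_; _≤_ to _≤ℚ_)
import Data.Rational.Properties as ℚ
open import Data.Sum using (_⊎_)
open import Function using (_∘_)
open import Function.Bundles using (module Equivalence)
open import Level using (0ℓ)
open import Relation.Binary.PropositionalEquality using (_≡_; subst)
open import Relation.Binary.Definitions using (tri<; tri≈; tri>)
open import Relation.Nullary using (¬_)
open import Relation.Nullary.Decidable using (⌊_⌋; toWitness; fromWitness)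
open import Relation.Unary using (Pred; Decidable)

-- Classical Dedekind reals. A real x is given by { q ∈ ℚ ∣ q < x }, an
-- inhabited, bounded, downward closed set of rationals without a greatest
-- element. The characteristic function is Bool-valued, so that ℝ is a
-- Set and infima of Set-indexed families, taken with excluded middle at level
-- 0ℓ, stay in ℝ.

record ℝ : Set where
  field
    lower     : ℚ → Bool
    inhabited : ∃[ q ] T (lower q)
    bounded   : ∃[ q ] ¬ T (lower q)
    downward  : ∀ {p q} → p <ℚ q → T (lower q) → T (lower p)
    rounded   : ∀ {q} → T (lower q) → ∃[ r ] (q <ℚ r × T (lower r))

open ℝ

_≤ℝ_ : ℝ → ℝ → Set
x ≤ℝ y = ∀ q → T (lower x q) → T (lower y q)

_<ℝ_ : ℝ → ℝ → Set
x <ℝ y = ∃[ q ] (¬ T (lower x q) × T (lower y q))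

fromℚ : ℚ → ℝ
fromℚ r .lower q = ⌊ q ℚ.<? r ⌋
fromℚ r .inhabited = r + - 1ℚ , fromWitness
  (subst (r + - 1ℚ <ℚ_) (ℚ.+-identityʳ r) (ℚ.+-monoʳ-< r (ℚ.negative⁻¹ (- 1ℚ))))
fromℚ r .bounded = r , ℚ.<-irrefl _≡_.refl ∘ toWitness
fromℚ r .downward p<q t = fromWitness (ℚ.<-trans p<q (toWitness t))
fromℚ r .rounded t with ℚ.<-dense (toWitness t)
... | m , q<m , m<r = m , q<m , fromWitness m<r

minℝ : ℝ → ℝ → ℝ
minℝ x y .lower q = lower x q Bool.∧ lower y q
minℝ x y .inhabited with inhabited x | inhabited y
... | p , p<x | q , q<y with ℚ.<-cmp p q
... | tri< p<q _ _ = p , Equivalence.from T-∧ (p<x , downward y p<q q<y)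
... | tri≈ _ p≡q _ =
      q , Equivalence.from T-∧ (subst (T ∘ lower x) p≡q p<x , q<y)
... | tri> _ _ q<p = q , Equivalence.from T-∧ (downward x q<p p<x , q<y)
minℝ x y .bounded with bounded x
... | q , q≮x = q , q≮x ∘ proj₁ ∘ Equivalence.to T-∧
minℝ x y .downward p<q t with Equivalence.to T-∧ t
... | q<x , q<y = Equivalence.from T-∧ (downward x p<q q<x , downward y p<q q<y)
minℝ x y .rounded t with Equivalence.to T-∧ t
... | q<x , q<y with rounded x q<x | rounded y q<y
... | r , q<r , r<x | s , q<s , s<y with ℚ.<-cmp r s
... | tri< r<s _ _ =
      r , q<r , Equivalence.from T-∧ (r<x , downward y r<s s<y)
... | tri≈ _ r≡s _ =
      s , q<s , Equivalence.from T-∧ (subst (T ∘ lower x) r≡s r<x , s<y)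
... | tri> _ _ s<r =
      s , q<s , Equivalence.from T-∧ (downward x s<r r<x , s<y)

-- The unit interval [0,1].

record 𝕀 : Set where
  constructor mk𝕀
  field
    value : ℝ
    0≤    : fromℚ 0ℚ ≤ℝ value
    ≤1    : value ≤ℝ fromℚ 1ℚ

open 𝕀

infix  4 _≤_ _<_ _≈_
infixr 6 _∧_

_≤_ _<_ _≈_ : 𝕀 → 𝕀 → Set
x ≤ y = value x ≤ℝ value y
x < y = value x <ℝ value y
x ≈ y = x ≤ y × y ≤ x

𝟎 𝟏 : 𝕀
𝟎 = mk𝕀 (fromℚ 0ℚ) (λ _ t → t)
  (λ _ t → fromWitness (ℚ.<-trans (toWitness t) (ℚ.positive⁻¹ 1ℚ)))
𝟏 = mk𝕀 (fromℚ 1ℚ)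
  (λ _ t → fromWitness (ℚ.<-trans (toWitness t) (ℚ.positive⁻¹ 1ℚ)))
  (λ _ t → t)

_∧_ : 𝕀 → 𝕀 → 𝕀
x ∧ y = mk𝕀 (minℝ (value x) (value y))
  (λ q t → Equivalence.from T-∧ (0≤ x q t , 0≤ y q t))
  (λ q t → ≤1 x q (proj₁ (Equivalence.to T-∧ t)))

∧-lowerˡ : ∀ x y → x ∧ y ≤ x
∧-lowerˡ x y q t = proj₁ (Equivalence.to T-∧ t)

∧-lowerʳ : ∀ x y → x ∧ y ≤ y
∧-lowerʳ x y q t = proj₂ (Equivalence.to (T-∧ {lower (value x) q}) t)

∧-greatest : ∀ {x y z} → z ≤ x → z ≤ y → z ≤ x ∧ y
∧-greatest z≤x z≤y q t = Equivalence.from T-∧ (z≤x q t , z≤y q t)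

-- q is strictly below the infimum in [0,1] of F when some rational r > q is
-- below every member of F. The clause r ≤ 1 matters only for an empty family,
-- whose infimum in [0,1] is 1.

Below : {I : Set} → (I → 𝕀) → ℚ → Set
Below F q = ∃[ r ] (q <ℚ r × r ≤ℚ 1ℚ × (∀ i → T (lower (value (F i)) r)))

⋀ : ExcludedMiddle 0ℓ → {I : Set} → (I → 𝕀) → 𝕀
⋀ em F = mk𝕀 inf nonneg atMost1
  where
  negative : ∀ {q} → q <ℚ 0ℚ → Below F q
  negative q<0 with ℚ.<-dense q<0
  ... | r , q<r , r<0 = r , q<r , ℚ.<⇒≤ (ℚ.<-trans r<0 (ℚ.positive⁻¹ 1ℚ)) ,
        λ i → 0≤ (F i) r (fromWitness r<0)

  below1 : ∀ {q} → Below F q → q <ℚ 1ℚ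
  below1 (r , q<r , r≤1 , _) = ℚ.<-≤-trans q<r r≤1

  inf : ℝ
  inf .lower q = ⌊ em {Below F q} ⌋
  inf .inhabited = - 1ℚ , fromWitness (negative (ℚ.negative⁻¹ (- 1ℚ)))
  inf .bounded = 1ℚ , ℚ.<-irrefl _≡_.refl ∘ below1 ∘ toWitness
  inf .downward p<q t with toWitness t
  ... | r , q<r , rest = fromWitness (r , ℚ.<-trans p<q q<r , rest)
  inf .rounded t with toWitness t
  ... | r , q<r , rest with ℚ.<-dense q<r
  ... | m , q<m , m<r = m , q<m , fromWitness (r , m<r , rest)

  nonneg : fromℚ 0ℚ ≤ℝ inf
  nonneg q t = fromWitness (negative (toWitness t))

  atMost1 : inf ≤ℝ fromℚ 1ℚ
  atMost1 q t = fromWitness (below1 (toWitness t))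

⋀-lower : ∀ (em : ExcludedMiddle 0ℓ) {I : Set} (F : I → 𝕀) i → ⋀ em F ≤ F i
⋀-lower em F i q t with toWitness t
... | r , q<r , _ , r<F = downward (value (F i)) q<r (r<F i)

⋀-greatest : ∀ (em : ExcludedMiddle 0ℓ) {I : Set} (F : I → 𝕀) z →
             (∀ i → z ≤ F i) → z ≤ ⋀ em F
⋀-greatest em F z z≤F q t with rounded (value z) t
... | r , q<r , r<z = fromWitness
      (r , q<r , ℚ.<⇒≤ (toWitness (≤1 z r r<z)) , λ i → z≤F i r r<z)

FuzzySubset : Set → Set
FuzzySubset X = X → 𝕀

infix 4 _⊆_

_⊆_ : {X : Set} → FuzzySubset X → FuzzySubset X → Set
A ⊆ B = ∀ x → A x ≤ B x

supp : {X : Set} → FuzzySubset X → Pred X 0ℓ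
supp A x = 𝟎 < A x

⋂ : ExcludedMiddle 0ℓ → {X I : Set} → (I → FuzzySubset X) → FuzzySubset X
⋂ em A x = ⋀ em (λ i → A i x)

IsFuzzyLanguage : {E : Set} → FuzzySubset (List E) → Set
IsFuzzyLanguage A =
  (∀ s → A s ≈ 𝟎) ⊎ (A [] ≈ 𝟏 × (∀ μ ν → A (μ ++ ν) ≤ A μ))

module _ {E : Set} where

  -- P(s) is kept as a string over E all of whose letters lie in Eo.
  proj : {Eo : Pred E 0ℓ} → Decidable Eo → List E → List E
  proj Eo? = filter Eo?

  Controllable : (L : FuzzySubset (List E)) (Euc : Pred E 0ℓ) →
                 FuzzySubset (List E) → Set
  Controllable L Euc M = ∀ s a → Euc a → M (s ∷ʳ a) ≈ M s ∧ L (s ∷ʳ a)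

  Observable : (L : FuzzySubset (List E)) {Eo : Pred E 0ℓ} → Decidable Eo →
               (Ec : Pred E 0ℓ) → FuzzySubset (List E) → Set
  Observable L Eo? Ec M =
    ∀ s s′ → supp M s → supp M s′ → proj Eo? s ≡ proj Eo? s′ →
    ∀ a → Ec a → supp M (s ∷ʳ a) →
    ∃[ x ] (M (s ∷ʳ a) ≈ M s ∧ L (s ∷ʳ a) ∧ x
          × M (s′ ∷ʳ a) ≈ M s′ ∧ L (s′ ∷ʳ a) ∧ x)

  -- The event set is partitioned into Ec and its complement, and into Eo and
  -- its complement.
  CO : (L : FuzzySubset (List E)) (Ec : Pred E 0ℓ) {Eo : Pred E 0ℓ} →
       Decidable Eo → (K : FuzzySubset (List E)) → Pred (FuzzySubset (List E)) 0ℓ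
  CO L Ec Eo? K M =
      IsFuzzyLanguage M
    × K ⊆ M
    × M ⊆ L
    × Controllable L (λ a → ¬ Ec a) M
    × Observable L Eo? Ec M

  infimalCO : ExcludedMiddle 0ℓ → (L : FuzzySubset (List E)) (Ec : Pred E 0ℓ)
              {Eo : Pred E 0ℓ} → Decidable Eo →
              FuzzySubset (List E) → FuzzySubset (List E)
  infimalCO em L Ec Eo? K =
    ⋂ em {I = Σ[ M ∈ FuzzySubset (List E) ] CO L Ec Eo? K M} proj₁

{-# OPTIONS --safe #-}
module Submission where

open import Defs
open import Axiom.ExcludedMiddle using (ExcludedMiddle)
open import Data.Fin using (Fin)
open import Data.List using (List; []; _++_; _∷ʳ_; [_])
open import Data.Nat using (ℕ)
open import Data.Product using (Σ-syntax; ∃-syntax; _×_; _,_; proj₁; proj₂)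
open import Data.Sum using (inj₁; inj₂)
open import Function.Bundles using (_↔_)
open import Level using (0ℓ)
open import Relation.Nullary using (yes; no; contradiction)
open import Relation.Unary using (Pred; Decidable)

open 𝕀 using (0≤; ≤1)

-- Meets commute with pointwise binary meets and, for inhabited families, with
-- meets by a constant, so controllability passes to intersections. For
-- observability, if x i is a threshold for the i-th language at (s , s′ , a),
-- then ⋀ x is one for the intersection; each x i exists because the support of
-- the intersection lies in every support. The class CO(K) is inhabited by L.

-- Endpoints are explicit arguments because `_≤_` unfolds to a condition on lower cuts alone, which
-- does not determine the remaining fields of its arguments.
≤-refl : ∀ x → x ≤ x
≤-refl x q t = t

≤-trans : ∀ x y z → x ≤ y → y ≤ z → x ≤ z
≤-trans x y z x≤y y≤z q t = y≤z q (x≤y q t)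

<-≤-trans : ∀ x y z → x < y → y ≤ z → x < z
<-≤-trans x y z (q , q≮x , q<y) y≤z = q , q≮x , y≤z q q<y

∧-monoˡ : ∀ x y z → x ≤ y → x ∧ z ≤ y ∧ z
∧-monoˡ x y z x≤y = ∧-greatest {y} {z} {x ∧ z}
  (≤-trans (x ∧ z) x y (∧-lowerˡ x z) x≤y) (∧-lowerʳ x z)

∧-monoʳ : ∀ x y z → y ≤ z → x ∧ y ≤ x ∧ z
∧-monoʳ x y z y≤z = ∧-greatest {x} {z} {x ∧ y}
  (∧-lowerˡ x y) (≤-trans (x ∧ y) y z (∧-lowerʳ x y) y≤z)

≈-trans : ∀ x y z → x ≈ y → y ≈ z → x ≈ z
≈-trans x y z (x≤y , y≤x) (y≤z , z≤y) =
  ≤-trans x y z x≤y y≤z , ≤-trans z y x z≤y y≤x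

∧-congʳ : ∀ x y z → y ≈ z → x ∧ y ≈ x ∧ z
∧-congʳ x y z (y≤z , z≤y) = ∧-monoʳ x y z y≤z , ∧-monoʳ x z y z≤y

∧-congˡ : ∀ x y z → x ≈ y → x ∧ z ≈ y ∧ z
∧-congˡ x y z (x≤y , y≤x) = ∧-monoˡ x y z x≤y , ∧-monoˡ y x z y≤x

x≤y⇒x≈y∧x : ∀ x y → x ≤ y → x ≈ y ∧ x
x≤y⇒x≈y∧x x y x≤y = ∧-greatest {y} {x} {x} x≤y (≤-refl x) , ∧-lowerʳ y x

x≈x∧𝟏 : ∀ x → x ≈ x ∧ 𝟏
x≈x∧𝟏 x = ∧-greatest {x} {𝟏} {x} (≤-refl x) (≤1 x) , ∧-lowerˡ x 𝟏

module _ (em : ExcludedMiddle 0ℓ) {I : Set} where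

  ⋀-mono : (F G : I → 𝕀) → (∀ i → F i ≤ G i) → ⋀ em F ≤ ⋀ em G
  ⋀-mono F G F≤G = ⋀-greatest em G (⋀ em F) λ i →
    ≤-trans (⋀ em F) (F i) (G i) (⋀-lower em F i) (F≤G i)

  ⋀-cong : (F G : I → 𝕀) → (∀ i → F i ≈ G i) → ⋀ em F ≈ ⋀ em G
  ⋀-cong F G F≈G =
    ⋀-mono F G (λ i → proj₁ (F≈G i)) , ⋀-mono G F (λ i → proj₂ (F≈G i))

  -- The index gives the upper bound: over an empty family the meet would be `𝟏`, whatever `x` is.
  ⋀-const : I → ∀ x → ⋀ em {I} (λ _ → x) ≈ x
  ⋀-const i x =
    ⋀-lower em (λ _ → x) i , ⋀-greatest em (λ _ → x) x (λ _ → ≤-refl x)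

  -- Both sides are the greatest lower bound of all the `F i` and `G i` taken together.
  ⋀-∧ : (F G : I → 𝕀) → ⋀ em (λ i → F i ∧ G i) ≈ ⋀ em F ∧ ⋀ em G
  ⋀-∧ F G =
      ∧-greatest {⋀ em F} {⋀ em G} {⋀ em H}
        (⋀-mono H F (λ i → ∧-lowerˡ (F i) (G i)))
        (⋀-mono H G (λ i → ∧-lowerʳ (F i) (G i)))
    , ⋀-greatest em H (⋀ em F ∧ ⋀ em G) λ i →
        ∧-greatest {F i} {G i} {⋀ em F ∧ ⋀ em G}
          (≤-trans (⋀ em F ∧ ⋀ em G) (⋀ em F) (F i)
            (∧-lowerˡ (⋀ em F) (⋀ em G)) (⋀-lower em F i))
          (≤-trans (⋀ em F ∧ ⋀ em G) (⋀ em G) (G i)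
            (∧-lowerʳ (⋀ em F) (⋀ em G)) (⋀-lower em G i))
    where
    H : I → 𝕀
    H i = F i ∧ G i

  ⋀-cong-∧ : (A F G : I → 𝕀) → (∀ i → A i ≈ F i ∧ G i) →
             ⋀ em A ≈ ⋀ em F ∧ ⋀ em G
  ⋀-cong-∧ A F G A≈F∧G = ≈-trans (⋀ em A) (⋀ em H) (⋀ em F ∧ ⋀ em G)
    (⋀-cong A H A≈F∧G) (⋀-∧ F G)
    where
    H : I → 𝕀
    H i = F i ∧ G i

  -- The shape of controllability: `c` stands for the value of `L` at `s ∷ʳ a`, which is the same
  -- for every language of the family.
  ⋀-factorʳ : I → (A F : I → 𝕀) (c : 𝕀) → (∀ i → A i ≈ F i ∧ c) →
              ⋀ em A ≈ ⋀ em F ∧ c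
  ⋀-factorʳ i A F c A≈F∧c =
    ≈-trans (⋀ em A) (⋀ em F ∧ ⋀ em C) (⋀ em F ∧ c)
      (⋀-cong-∧ A F C A≈F∧c)
      (∧-congʳ (⋀ em F) (⋀ em C) c (⋀-const i c))
    where
    C : I → 𝕀
    C _ = c

  -- The shape of observability, with `G` the family of thresholds. As `_∧_` associates to the
  -- right, `⋀-∧` first splits off `F` and then separates `c` from `G`.
  ⋀-factor-mid : I → (A F G : I → 𝕀) (c : 𝕀) → (∀ i → A i ≈ F i ∧ c ∧ G i) →
                 ⋀ em A ≈ ⋀ em F ∧ c ∧ ⋀ em G
  ⋀-factor-mid i A F G c A≈F∧c∧G =
    ≈-trans (⋀ em A) (⋀ em F ∧ ⋀ em H) (⋀ em F ∧ c ∧ ⋀ em G)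
      (⋀-cong-∧ A F H A≈F∧c∧G)
      (∧-congʳ (⋀ em F) (⋀ em H) (c ∧ ⋀ em G)
        (≈-trans (⋀ em H) (⋀ em C ∧ ⋀ em G) (c ∧ ⋀ em G)
          (⋀-∧ C G)
          (∧-congˡ (⋀ em C) c (⋀ em G) (⋀-const i c))))
    where
    C H : I → 𝕀
    C _ = c
    H j = c ∧ G j

  module _ {E : Set} (M : I → FuzzySubset (List E)) where

    ⋂-lower : ∀ i → ⋂ em M ⊆ M i
    ⋂-lower i s = ⋀-lower em (λ j → M j s) i

    -- Excluded middle decides which alternative holds. One vanishing member forces the intersection
    -- to vanish; if there is none, every member satisfies the second alternative, which meets
    -- preserve.
    ⋂-isFuzzyLanguage : (∀ i → IsFuzzyLanguage (M i)) → IsFuzzyLanguage (⋂ em M)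
    ⋂-isFuzzyLanguage lang with em {∃[ i ] (∀ s → M i s ≈ 𝟎)}
    ... | yes (i , M≈𝟎) = inj₁ λ s →
            ≤-trans (⋂ em M s) (M i s) 𝟎 (⋂-lower i s) (proj₁ (M≈𝟎 s))
          , 0≤ (⋂ em M s)
    ... | no ∄zero = inj₂
          ( (≤1 (⋂ em M []) , ⋀-greatest em (λ i → M i []) 𝟏 𝟏≤M[])
          , λ μ ν → ⋀-mono (λ i → M i (μ ++ ν)) (λ i → M i μ) (λ i → prefix i μ ν))
      where
      𝟏≤M[] : ∀ i → 𝟏 ≤ M i []
      𝟏≤M[] i with lang i
      ... | inj₁ M≈𝟎 = contradiction (i , M≈𝟎) ∄zero
      ... | inj₂ (M[]≈𝟏 , _) = proj₂ M[]≈𝟏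

      prefix : ∀ i μ ν → M i (μ ++ ν) ≤ M i μ
      prefix i with lang i
      ... | inj₁ M≈𝟎 = contradiction (i , M≈𝟎) ∄zero
      ... | inj₂ (_ , anti) = anti

    module _ (i₀ : I) (L : FuzzySubset (List E)) where

      ⋂-controllable : (Euc : Pred E 0ℓ) → (∀ i → Controllable L Euc (M i)) →
                       Controllable L Euc (⋂ em M)
      ⋂-controllable Euc ctrl s a a∈Euc =
        ⋀-factorʳ i₀ (λ i → M i (s ∷ʳ a)) (λ i → M i s) (L (s ∷ʳ a))
          (λ i → ctrl i s a a∈Euc)

      ⋂-observable : {Eo : Pred E 0ℓ} (Eo? : Decidable Eo) (Ec : Pred E 0ℓ) →
                     (∀ i → Observable L Eo? Ec (M i)) →
                     Observable L Eo? Ec (⋂ em M)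
      ⋂-observable Eo? Ec obs s s′ s∈ s′∈ Ps≡Ps′ a a∈Ec sa∈ =
          ⋀ em x
        , ⋀-factor-mid i₀ (λ i → M i (s ∷ʳ a)) (λ i → M i s) x (L (s ∷ʳ a))
            (λ i → proj₁ (proj₂ (threshold i)))
        , ⋀-factor-mid i₀ (λ i → M i (s′ ∷ʳ a)) (λ i → M i s′) x (L (s′ ∷ʳ a))
            (λ i → proj₂ (proj₂ (threshold i)))
        where
        supp-⋂ : ∀ i t → supp (⋂ em M) t → supp (M i) t
        supp-⋂ i t t∈ = <-≤-trans 𝟎 (⋂ em M t) (M i t) t∈ (⋂-lower i t)

        threshold : ∀ i →
          ∃[ y ] (M i (s ∷ʳ a) ≈ M i s ∧ L (s ∷ʳ a) ∧ y
                × M i (s′ ∷ʳ a) ≈ M i s′ ∧ L (s′ ∷ʳ a) ∧ y)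
        threshold i = obs i s s′ (supp-⋂ i s s∈) (supp-⋂ i s′ s′∈) Ps≡Ps′
          a a∈Ec (supp-⋂ i (s ∷ʳ a) sa∈)

        -- The existential in `Observable` is a Σ-type, so projecting yields the whole family of
        -- thresholds without an appeal to choice.
        x : I → 𝕀
        x i = proj₁ (threshold i)

language-∷ʳ-≤ : {E : Set} (L : FuzzySubset (List E)) → IsFuzzyLanguage L →
                ∀ s a → L (s ∷ʳ a) ≤ L s
language-∷ʳ-≤ L (inj₁ L≈𝟎) s a =
  ≤-trans (L (s ∷ʳ a)) 𝟎 (L s) (proj₁ (L≈𝟎 (s ∷ʳ a))) (0≤ (L s))
-- `s ∷ʳ a` unfolds to `s ++ [ a ]`, so this is an instance of the prefix inequality.
language-∷ʳ-≤ L (inj₂ (_ , anti)) s a = anti s [ a ]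

module _ {E : Set} (L : FuzzySubset (List E)) (lang : IsFuzzyLanguage L) where

  self-controllable : (Euc : Pred E 0ℓ) → Controllable L Euc L
  self-controllable Euc s a _ =
    x≤y⇒x≈y∧x (L (s ∷ʳ a)) (L s) (language-∷ʳ-≤ L lang s a)

  self-observable : {Eo : Pred E 0ℓ} (Eo? : Decidable Eo) (Ec : Pred E 0ℓ) →
                    Observable L Eo? Ec L
  -- The threshold `𝟏` imposes no restriction, and the value of `L` at `t ∷ʳ a` already lies below
  -- its value at `t`.
  self-observable Eo? Ec s s′ _ _ _ a _ _ = 𝟏 , at s , at s′
    where
    at : ∀ t → L (t ∷ʳ a) ≈ L t ∧ L (t ∷ʳ a) ∧ 𝟏
    at t = ≈-trans (L (t ∷ʳ a)) (L t ∧ L (t ∷ʳ a)) (L t ∧ L (t ∷ʳ a) ∧ 𝟏)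
      (x≤y⇒x≈y∧x (L (t ∷ʳ a)) (L t) (language-∷ʳ-≤ L lang t a))
      (∧-congʳ (L t) (L (t ∷ʳ a)) (L (t ∷ʳ a) ∧ 𝟏) (x≈x∧𝟏 (L (t ∷ʳ a))))

  self-CO : (Ec : Pred E 0ℓ) {Eo : Pred E 0ℓ} (Eo? : Decidable Eo)
            (K : FuzzySubset (List E)) → K ⊆ L → CO L Ec Eo? K L
  self-CO Ec Eo? K K⊆L =
    lang , K⊆L , (λ s → ≤-refl (L s)) ,
    self-controllable _ , self-observable Eo? Ec

proposition4 : (em : ExcludedMiddle 0ℓ) (E : Set) (n : ℕ) → E ↔ Fin n →
    (Ec : Pred E 0ℓ) → Decidable Ec → (Eo : Pred E 0ℓ) (Eo? : Decidable Eo) →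
    (L : FuzzySubset (List E)) → IsFuzzyLanguage L →
    (K : FuzzySubset (List E)) → IsFuzzyLanguage K → K ⊆ L →
    CO L Ec Eo? K (infimalCO em L Ec Eo? K)
    × ((M : FuzzySubset (List E)) → CO L Ec Eo? K M → infimalCO em L Ec Eo? K ⊆ M)
proposition4 em E _ _ Ec _ Eo Eo? L langL K _ K⊆L =
    ( ⋂-isFuzzyLanguage em M (λ (_ , lang , _) → lang)
    , (λ s → ⋀-greatest em (λ i → M i s) (K s) λ (_ , _ , K⊆M , _) → K⊆M s)
    -- `L` is itself a member, so the intersection lies below it. In the next two components the
    -- same member witnesses that the family is inhabited.
    , ⋂-lower em M L∈CO
    , ⋂-controllable em M L∈CO L _ (λ (_ , _ , _ , _ , ctrl , _) → ctrl)
    , ⋂-observable em M L∈CO L Eo? Ec (λ (_ , _ , _ , _ , _ , obs) → obs))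
  , λ N N∈CO → ⋂-lower em M (N , N∈CO)
  where
  -- With this index type and `M` the first projection, `⋂ em M` is `infimalCO` by definition.
  I : Set
  I = Σ[ N ∈ FuzzySubset (List E) ] CO L Ec Eo? K N

  M : I → FuzzySubset (List E)
  M = proj₁

  L∈CO : I
  L∈CO = L , self-CO L langL Ec Eo? K K⊆L
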